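{- Let $\Sigma$ be an algebraic signature and $S$ a countable set of states. There is a bijective correspondence between: (1) stateful SOS specifications (over $\Sigma$ and $S$); (2) stateful SOS laws, i.e. natural transformations with components $\delta_X\colon S\times\Sigma(X\times (S\times(X+1)))\to S\times(\Sigma^{\star}X+1)$, $X\in\mathbf{Set}$; (3) families of maps of the form $$\big(r_{\mathsf f,W}\colon S\times S^{\mathrm{ar}(\mathsf f)}\to S\times\Sigma^{\star}(\mathrm{ar}(\mathsf f)+W)+S\big)_{\mathsf f\in\Sigma,\,W\subseteq \mathrm{ar}(\mathsf f)},$$ where the natural number $\mathrm{ar}(\mathsf f)$ is identified with the set $\{1,\dots,\mathrm{ar}(\mathsf f)\}$. The correspondence between (1) and (2) is given by the translations $\mathcal L\mapsto\delta$ and $\delta\mapsto\mathcal L$ described in the context.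
   Context: **Signature and terms.** An algebraic signature $\Sigma$ is a set of operation symbols $\mathsf f$ with arities $\mathrm{ar}(\mathsf f)\in\mathbb N$; it is identified with the polynomial functor $\Sigma X=\coprod_{\mathsf f\in\Sigma}X^{\mathrm{ar}(\mathsf f)}$ on $\mathbf{Set}$. $\Sigma^{\star}X$ is the set of $\Sigma$-terms with variables from $X$ (the free $\Sigma$-algebra on $X$; $\Sigma^\star$ is the free monad on $\Sigma$). $1=\{*\}$. Fix a countably infinite set $\mathcal V=\{x_1,x_2,\dots\}\cup\{y_1,y_2,\dots\}$ of (distinct) variables. **Literals.** A progressing literal is an expression $s,p\to s',q$ with $s,s'\in S$, $p,q\in\Sigma^\star\mathcal V$ (input $s$, source $p$, output $s'$, target $q$). A terminating literal is an expression $s,p\downarrow s'$ with $s,s'\in S$, $p\in\Sigma^\star\mathcal V$ (input $s$, source $p$, output $s'$). A literal is either of these. **Rules.** A stateful SOS rule for an $n$-ary $\mathsf f\in\Sigma$ is an expression $l_1\ \dots\ l_n/L$ where the premisses $l_1,\dots,l_n$ and the conclusion $L$ are literals having the same input $s\in S$ (the input of the rule) such that: (i) the source of $l_j$ is the variable $x_j$, and its target is $y_j$ if $l_j$ is progressing; (ii) the source of $L$ is $\mathsf f(x_1,\dots,x_n)$ and, if $L$ is progressing, all variables of its target term appear as the source or the target of some premiss. The rule is progressing/terminating if $L$ is. The trigger of the rule is the input $s$ together with the sequence $(s_1',\mathtt c_1),\dots,(s_n',\mathtt c_n)$, where $s_j'$ is the output of $l_j$ and $\mathtt c_j=\mathtt{pr}$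 if $l_j$ is progressing, $\mathtt c_j=\mathtt{te}$ if $l_j$ is terminating. **Specifications.** A stateful SOS specification is a set of stateful SOS rules such that for each $n$-ary $\mathsf f\in\Sigma$, each $s\in S$ and each sequence $(s_1',\mathtt c_1),\dots,(s_n',\mathtt c_n)$ with $s_j'\in S$, $\mathtt c_j\in\{\mathtt{pr},\mathtt{te}\}$, there is exactly one rule for $\mathsf f$ with trigger $(s,(s_1',\mathtt c_1),\dots,(s_n',\mathtt c_n))$. **Translation $\mathcal L\mapsto\delta$.** By distributing $S\times(-)$ over coproducts, $\delta_X$ is the copairing of maps $\delta_X^{\mathsf f}\colon S\times (X\times (S\times(X+1)))^{\mathrm{ar}(\mathsf f)}\to S\times(\Sigma^\star X+1)$, $\mathsf f\in\Sigma$. Given $(s,((v_1,s_1',w_1),\dots,(v_n,s_n',w_n)))$, take the unique rule of $\mathcal L$ for $\mathsf f$ with trigger $(s,(s_1',\mathtt c_1),\dots,(s_n',\mathtt c_n))$, where $\mathtt c_j=\mathtt{pr}$ if $w_j\in X$ and $\mathtt c_j=\mathtt{te}$ if $w_j=*$; let $s'$ be the output of its conclusion. The value of $\delta_X^{\mathsf f}$ is $(s',*)$ if the rule is terminating, and otherwise $(s',t')$, where $t'$ is obtained from the target $t$ of the conclusion by substituting $v_j$ for $x_j$, and $w_j$ for $y_j$ whenever $\mathtt c_j=\mathtt{pr}$. **Translation $\delta\mapsto\mathcal L$.** For every $n$-ary $\mathsf f$, all $s,s_1',\dots,s_n'\in S$ and $W\subseteq\{1,\dots,n\}$, let $(s',t)=\delta^{\mathsf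 f}_{\mathcal V}(s,((x_1,s_1',w_1),\dots,(x_n,s_n',w_n)))$, where $w_j=y_j$ if $j\in W$ and $w_j=*$ otherwise. Then $\mathcal L$ contains the rule with premisses $s,x_j\to s_j',y_j$ for $j\in W$ and $s,x_j\downarrow s_j'$ for $j\notin W$, and conclusion $s,\mathsf f(x_1,\dots,x_n)\to s',t$ if $t\in\Sigma^\star\mathcal V$, respectively $s,\mathsf f(x_1,\dots,x_n)\downarrow s'$ if $t=*$. -}

module Defs where

open import Level using (0ℓ) renaming (suc to ℓsuc)
open import Data.Bool using (if_then_else_)
open import Data.Fin using (Fin; toℕ)
open import Data.Fin.Subset using (Subset) renaming (_∈_ to _∈ˢ_)
open import Data.Maybe as Maybe using (Maybe; just; nothing)
open import Data.Nat using (ℕ; zero; suc)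
open import Data.Product using (Σ-syntax; ∃; ∃₂; ∃!; _×_; _,_; proj₁; proj₂; map₂)
open import Data.Sum as Sum using (_⊎_; inj₁; inj₂)
open import Data.Unit using (⊤; tt)
open import Data.Vec as Vec using (Vec; []; _∷_; lookup; tabulate)
open import Data.Vec.Relation.Unary.Any using (Any)
open import Function using (_↣_; id)
open import Relation.Binary using (Setoid)
open import Relation.Binary.PropositionalEquality using (_≡_; refl; sym; trans)
open import Relation.Unary using (Pred; _∈_; _≐_)
open import Relation.Unary.Properties using (≐-refl; ≐-sym; ≐-trans)

-- Finite sets count as countable.
Countable : Set → Set
Countable A = A ↣ ℕ

record Signature : Set₁ where
  field
    Op : Set
    ar : Op → ℕ

-- The variables are numbered from 0, so that the j-th argument position,
-- j : Fin n, has the variables x (toℕ j) and y (toℕ j).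
data 𝒱 : Set where
  x y : ℕ → 𝒱

data Mode : Set where
  pr te : Mode

lookupℕ : {A : Set} {n : ℕ} → Vec A n → ℕ → Maybe A
lookupℕ []       _       = nothing
lookupℕ (a ∷ _)  zero    = just a
lookupℕ (_ ∷ as) (suc i) = lookupℕ as i

module StatefulSOS (Sg : Signature) (S : Set) where
  open Signature Sg

  -- The polynomial functor of the signature.  Arguments are vectors rather
  -- than functions Fin (ar f) → X, so that _≡_ is the intended equality
  -- without function extensionality.
  ⟦Σ⟧ : Set → Set
  ⟦Σ⟧ X = Σ[ f ∈ Op ] Vec X (ar f)

  mapΣ : {X Y : Set} → (X → Y) → ⟦Σ⟧ X → ⟦Σ⟧ Y
  mapΣ g = map₂ (Vec.map g)

  data Term (X : Set) : Set where
    var : X → Term X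
    op  : (f : Op) → Vec (Term X) (ar f) → Term X

  mutual
    mapTerm : {X Y : Set} → (X → Y) → Term X → Term Y
    mapTerm g (var v)   = var (g v)
    mapTerm g (op f ts) = op f (mapTerms g ts)

    mapTerms : {X Y : Set} {n : ℕ} → (X → Y) → Vec (Term X) n → Vec (Term Y) n
    mapTerms g []       = []
    mapTerms g (t ∷ ts) = mapTerm g t ∷ mapTerms g ts

  data _occursIn_ {X : Set} (v : X) : Term X → Set where
    here   : v occursIn var v
    inside : {f : Op} {ts : Vec (Term X) (ar f)} →
             Any (v occursIn_) ts → v occursIn op f ts

  -- Substitution of variables along a partial assignment; it is defined
  -- precisely when every variable of the term has a value.
  mutual
    substitute : {X Y : Set} → (X → Maybe Y) → Term X → Maybe (Term Y)
    substitute σ (var v)   = Maybe.map var (σ v)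
    substitute σ (op f ts) = Maybe.map (op f) (substitutes σ ts)

    substitutes : {X Y : Set} {n : ℕ} →
                  (X → Maybe Y) → Vec (Term X) n → Maybe (Vec (Term Y) n)
    substitutes σ []       = just []
    substitutes σ (t ∷ ts) = Maybe.zipWith _∷_ (substitute σ t) (substitutes σ ts)

  data Literal : Set where
    _,_⟶_,_ : (s : S) (p : Term 𝒱) (s′ : S) (q : Term 𝒱) → Literal
    _,_↓_   : (s : S) (p : Term 𝒱) (s′ : S) → Literal

  input : Literal → S
  input (s , _ ⟶ _ , _) = s
  input (s , _ ↓ _)     = s

  source : Literal → Term 𝒱
  source (_ , p ⟶ _ , _) = p
  source (_ , p ↓ _)     = p

  output : Literal → S
  output (_ , _ ⟶ s′ , _) = s′
  output (_ , _ ↓ s′)     = s′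

  target : Literal → Maybe (Term 𝒱)
  target (_ , _ ⟶ _ , q) = just q
  target (_ , _ ↓ _)     = nothing

  mode : Literal → Mode
  mode (_ , _ ⟶ _ , _) = pr
  mode (_ , _ ↓ _)     = te

  record RuleExpr (n : ℕ) : Set where
    constructor _/_
    field
      premisses  : Vec Literal n
      conclusion : Literal
  open RuleExpr public

  f⟨x⟩ : Op → Term 𝒱
  f⟨x⟩ f = op f (tabulate λ j → var (x (toℕ j)))

  record IsRule (f : Op) (r : RuleExpr (ar f)) : Set where
    field
      sameInput        : ∀ j → input (lookup (premisses r) j) ≡ input (conclusion r)
      premissSource    : ∀ j → source (lookup (premisses r) j) ≡ var (x (toℕ j))
      premissTarget    : ∀ j {q} → target (lookup (premisses r) j) ≡ just q →
                         q ≡ var (y (toℕ j))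
      conclusionSource : source (conclusion r) ≡ f⟨x⟩ f
      conclusionTarget : ∀ {q v} → target (conclusion r) ≡ just q → v occursIn q →
                         ∃ λ j → source (lookup (premisses r) j) ≡ var v
                               ⊎ target (lookup (premisses r) j) ≡ just (var v)

  Trigger : ℕ → Set
  Trigger n = S × Vec (S × Mode) n

  trigger : {n : ℕ} → RuleExpr n → Trigger n
  trigger r = input (conclusion r) , Vec.map (λ l → output l , mode l) (premisses r)

  -- A set of rules, split according to the operation symbol f; nothing is
  -- lost, since the conclusion of a rule determines f.
  RuleSet : Set₁
  RuleSet = (f : Op) → Pred (RuleExpr (ar f)) 0ℓ

  record Specification : Set₁ where
    field
      rules  : RuleSet
      isRule : ∀ f {r} → r ∈ rules f → IsRule f r
      unique : ∀ f (τ : Trigger (ar f)) →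
               ∃! _≡_ λ r → r ∈ rules f × trigger r ≡ τ
  open Specification public

  Arg : Set → Set
  Arg X = X × (S × (X ⊎ ⊤))

  mapArg : {X Y : Set} → (X → Y) → Arg X → Arg Y
  mapArg g (v , s , w) = g v , s , Sum.map g id w

  Dom Cod : Set → Set
  Dom X = S × ⟦Σ⟧ (Arg X)
  Cod X = S × (Term X ⊎ ⊤)

  mapDom : {X Y : Set} → (X → Y) → Dom X → Dom Y
  mapDom g = map₂ (mapΣ (mapArg g))

  mapCod : {X Y : Set} → (X → Y) → Cod X → Cod Y
  mapCod g = map₂ (Sum.map (mapTerm g) id)

  record Law : Set₁ where
    field
      δ       : (X : Set) → Dom X → Cod X
      natural : {X Y : Set} (g : X → Y) (z : Dom X) →
                δ Y (mapDom g z) ≡ mapCod g (δ X z)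
  open Law public

  -- The subset W as a set in its own right.
  Elements : {n : ℕ} → Subset n → Set
  Elements W = ∃ λ j → j ∈ˢ W

  Family : Set
  Family = (f : Op) (W : Subset (ar f)) →
           S × Vec S (ar f) → (S × Term (Fin (ar f) ⊎ Elements W)) ⊎ S

  -- The Setoid equalities are the extensional ones: equality of sets of
  -- rules, of natural transformations, and of families of maps.
  specifications : Setoid (ℓsuc 0ℓ) 0ℓ
  specifications = record
    { Carrier       = Specification
    ; _≈_           = λ L L′ → ∀ f → rules L f ≐ rules L′ f
    ; isEquivalence = record
      { refl  = λ _ → ≐-refl
      ; sym   = λ e f → ≐-sym (e f)
      ; trans = λ e e′ f → ≐-trans (e f) (e′ f)
      }
    }

  laws : Setoid (ℓsuc 0ℓ) (ℓsuc 0ℓ)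
  laws = record
    { Carrier       = Law
    ; _≈_           = λ d d′ → (X : Set) (z : Dom X) → δ d X z ≡ δ d′ X z
    ; isEquivalence = record
      { refl  = λ _ _ → refl
      ; sym   = λ e X z → sym (e X z)
      ; trans = λ e e′ X z → trans (e X z) (e′ X z)
      }
    }

  families : Setoid 0ℓ 0ℓ
  families = record
    { Carrier       = Family
    ; _≈_           = λ r r′ → ∀ f W z → r f W z ≡ r′ f W z
    ; isEquivalence = record
      { refl  = λ _ _ _ → refl
      ; sym   = λ e f W z → sym (e f W z)
      ; trans = λ e e′ f W z → trans (e f W z) (e′ f W z)
      }
    }

  modeOf : {X : Set} → X ⊎ ⊤ → Mode
  modeOf (inj₁ _) = pr
  modeOf (inj₂ _) = te

  triggerOf : {X : Set} {n : ℕ} → S → Vec (Arg X) n → Trigger n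
  triggerOf s as = s , Vec.map (λ { (_ , s′ , w) → s′ , modeOf w }) as

  -- x_j ↦ v_j, and y_j ↦ w_j if w_j is in X; undefined elsewhere.
  assign : {X : Set} {n : ℕ} → Vec (Arg X) n → 𝒱 → Maybe X
  assign as (x i) = Maybe.map proj₁ (lookupℕ as i)
  assign as (y i) = lookupℕ as i Maybe.>>= λ { (_ , _ , w) → Sum.[ just , (λ _ → nothing) ] w }

  data Value {X : Set} {n : ℕ} (as : Vec (Arg X) n) : Literal → Cod X → Set where
    terminating : ∀ {s p s′} → Value as (s , p ↓ s′) (s′ , inj₂ tt)
    progressing : ∀ {s p s′ t t′} → substitute (assign as) t ≡ just t′ →
                  Value as (s , p ⟶ s′ , t) (s′ , inj₁ t′)

  -- d is the translation of L.  Since L has exactly one rule with the given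
  -- trigger, and Value is functional, this determines d up to equality of laws.
  IsLawOf : Specification → Law → Set₁
  IsLawOf L d = (X : Set) (s : S) (f : Op) (as : Vec (Arg X) (ar f)) →
                ∀ r → r ∈ rules L f → trigger r ≡ triggerOf s as →
                Value as (conclusion r) (δ d X (s , f , as))

  module _ (d : Law) (f : Op) (s : S) (ss : Vec S (ar f)) (W : Subset (ar f)) where
    argsOf : Vec (Arg 𝒱) (ar f)
    argsOf = tabulate λ j →
      x (toℕ j) , lookup ss j , (if lookup W j then inj₁ (y (toℕ j)) else inj₂ tt)

    premissesOf : Vec Literal (ar f)
    premissesOf = tabulate λ j →
      if lookup W j
        then s , var (x (toℕ j)) ⟶ lookup ss j , var (y (toℕ j))
        else s , var (x (toℕ j)) ↓ lookup ss j

    conclusionOf : Literal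
    conclusionOf with δ d 𝒱 (s , f , argsOf)
    ... | s′ , inj₁ t  = s , f⟨x⟩ f ⟶ s′ , t
    ... | s′ , inj₂ tt = s , f⟨x⟩ f ↓ s′

    ruleOf : RuleExpr (ar f)
    ruleOf = premissesOf / conclusionOf

  rulesOf : Law → RuleSet
  rulesOf d f r = ∃₂ λ s ss → ∃ λ W → r ≡ ruleOf d f s ss W

  IsSpecificationOf : Law → Specification → Set
  IsSpecificationOf d L = ∀ f → rules L f ≐ rulesOf d f

{-# OPTIONS --safe #-}
module Submission where

-- For an n-ary f, outputs ss and a set W of progressing positions, let the
-- generic argument vector take values in n + W itself.  Every argument vector
-- is the image of a unique generic one under a valuation n + W → X, so by
-- naturality a law amounts to its values on the generic vectors, which is a
-- family.  The rules of a law are its values under the injection of n + W into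
-- the variables x_j, y_j; that their targets contain only these variables is
-- again naturality.  Laws and rules are compared through n + W and not through
-- a map 𝒱 → X, which need not exist, since X may be empty.

open import Defs
open import Data.Bool using (Bool; true; false; if_then_else_)
open import Data.Fin using (Fin; zero; suc; toℕ)
open import Data.Fin.Subset using (Subset) renaming (_∈_ to _∈ˢ_)
open import Data.Maybe as Maybe using (Maybe; just; nothing)
open import Data.Maybe.Properties using (just-injective)
open import Data.Nat using (ℕ; zero; suc)
open import Data.Product using (Σ-syntax; ∃; _×_; _,_; proj₁; proj₂)
open import Data.Sum as Sum using (_⊎_; inj₁; inj₂)
open import Data.Sum.Properties using (inj₁-injective)
open import Data.Unit using (⊤; tt)
open import Data.Vec as Vec using (Vec; []; _∷_; lookup; tabulate; here; there)
open import Data.Vec.Properties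
  using (tabulate∘lookup; lookup∘tabulate; tabulate-cong; lookup-map; map-∘; map-cong; map-id;
         []=⇒lookup)
open import Data.Vec.Relation.Unary.Any using (Any; here; there)
open import Function using (_∘_; id)
open import Function.Bundles using (Inverse)
open import Relation.Binary using (Setoid)
open import Relation.Binary.PropositionalEquality
  using (_≡_; refl; sym; trans; cong; cong₂; subst; module ≡-Reasoning)
open import Relation.Unary using (_∈_)
open import Relation.Unary.Properties using (≐-refl)

lookup-ext : {A : Set} {n : ℕ} {as bs : Vec A n} →
             (∀ j → lookup as j ≡ lookup bs j) → as ≡ bs
lookup-ext {as = as} {bs} e =
  trans (sym (tabulate∘lookup as)) (trans (tabulate-cong e) (tabulate∘lookup bs))

module _ (Sg : Signature) (S : Set) where
  open Signature Sg
  open StatefulSOS Sg S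

  private variable
    X Y Z : Set
    n : ℕ
    W : Subset n

  -- Terms and substitution

  mutual
    mapTerm-id : (t : Term X) → mapTerm id t ≡ t
    mapTerm-id (var v)   = refl
    mapTerm-id (op f ts) = cong (op f) (mapTerms-id ts)

    mapTerms-id : (ts : Vec (Term X) n) → mapTerms id ts ≡ ts
    mapTerms-id []       = refl
    mapTerms-id (t ∷ ts) = cong₂ _∷_ (mapTerm-id t) (mapTerms-id ts)

  mutual
    mapTerm-cong : {g h : X → Y} → (∀ v → g v ≡ h v) →
                   (t : Term X) → mapTerm g t ≡ mapTerm h t
    mapTerm-cong e (var v)   = cong var (e v)
    mapTerm-cong e (op f ts) = cong (op f) (mapTerms-cong e ts)

    mapTerms-cong : {g h : X → Y} → (∀ v → g v ≡ h v) →
                    (ts : Vec (Term X) n) → mapTerms g ts ≡ mapTerms h ts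
    mapTerms-cong e []       = refl
    mapTerms-cong e (t ∷ ts) = cong₂ _∷_ (mapTerm-cong e t) (mapTerms-cong e ts)

  mutual
    mapTerm-∘ : (g : Y → Z) (h : X → Y) (t : Term X) →
                mapTerm (g ∘ h) t ≡ mapTerm g (mapTerm h t)
    mapTerm-∘ g h (var v)   = refl
    mapTerm-∘ g h (op f ts) = cong (op f) (mapTerms-∘ g h ts)

    mapTerms-∘ : (g : Y → Z) (h : X → Y) (ts : Vec (Term X) n) →
                 mapTerms (g ∘ h) ts ≡ mapTerms g (mapTerms h ts)
    mapTerms-∘ g h []       = refl
    mapTerms-∘ g h (t ∷ ts) = cong₂ _∷_ (mapTerm-∘ g h t) (mapTerms-∘ g h ts)

  mutual
    occursIn-mapTerm : (g : X → Y) (t : Term X) {v : Y} →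
                       v occursIn mapTerm g t → ∃ λ u → v ≡ g u
    occursIn-mapTerm g (var u)   here       = u , refl
    occursIn-mapTerm g (op f ts) (inside o) = occursIn-mapTerms g ts o

    occursIn-mapTerms : (g : X → Y) (ts : Vec (Term X) n) {v : Y} →
                        Any (v occursIn_) (mapTerms g ts) → ∃ λ u → v ≡ g u
    occursIn-mapTerms g (t ∷ ts) (here o)  = occursIn-mapTerm g t o
    occursIn-mapTerms g (t ∷ ts) (there o) = occursIn-mapTerms g ts o

  mutual
    -- Meant for `h` the naming of slots by variables: `σ` has to be defined only on the image of
    -- `h`, so a partial assignment acts on a renamed term as a total map.
    substitute-mapTerm : {σ : Y → Maybe Z} {h : X → Y} {g : X → Z} →
                         (∀ u → σ (h u) ≡ just (g u)) →
                         (t : Term X) → substitute σ (mapTerm h t) ≡ just (mapTerm g t)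
    substitute-mapTerm e (var u)   = cong (Maybe.map var) (e u)
    substitute-mapTerm e (op f ts) = cong (Maybe.map (op f)) (substitutes-mapTerms e ts)

    substitutes-mapTerms : {σ : Y → Maybe Z} {h : X → Y} {g : X → Z} →
                           (∀ u → σ (h u) ≡ just (g u)) →
                           (ts : Vec (Term X) n) →
                           substitutes σ (mapTerms h ts) ≡ just (mapTerms g ts)
    substitutes-mapTerms e []       = refl
    substitutes-mapTerms e (t ∷ ts) =
      cong₂ (Maybe.zipWith _∷_) (substitute-mapTerm e t) (substitutes-mapTerms e ts)

  substitute-just : (t : Term X) → substitute just t ≡ just t
  substitute-just t = subst (λ p → substitute just p ≡ just p) (mapTerm-id t)
    (substitute-mapTerm {h = id} (λ _ → refl) t)

  mutual
    -- Asks for values only at the variables that occur, which is the form in which the condition on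
    -- the target of a rule supplies them.
    substitute-total : {σ : X → Maybe Y} (t : Term X) →
                       (∀ {v} → v occursIn t → ∃ λ u → σ v ≡ just u) →
                       ∃ λ t′ → substitute σ t ≡ just t′
    substitute-total (var v) def with def here
    ... | u , e = var u , cong (Maybe.map var) e
    substitute-total (op f ts) def with substitutes-total ts (def ∘ inside)
    ... | ts′ , e = op f ts′ , cong (Maybe.map (op f)) e

    substitutes-total : {σ : X → Maybe Y} (ts : Vec (Term X) n) →
                        (∀ {v} → Any (v occursIn_) ts → ∃ λ u → σ v ≡ just u) →
                        ∃ λ ts′ → substitutes σ ts ≡ just ts′
    substitutes-total []       def = [] , refl
    substitutes-total (t ∷ ts) def
      with substitute-total t (def ∘ here) | substitutes-total ts (def ∘ there)
    ... | t′ , e | ts′ , e′ = t′ ∷ ts′ , cong₂ (Maybe.zipWith _∷_) e e′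

  mutual
    -- Serves two purposes: naturality of values, with `τ` the assignment of the mapped arguments,
    -- and, with `τ = just`, the fact that a substitution fixing each variable where it is defined
    -- returns the term itself.
    substitute-mono : {σ : X → Maybe Y} {τ : X → Maybe Z} {g : Y → Z} →
                      (∀ v {u} → σ v ≡ just u → τ v ≡ just (g u)) →
                      (t : Term X) {t′ : Term Y} →
                      substitute σ t ≡ just t′ → substitute τ t ≡ just (mapTerm g t′)
    substitute-mono {σ = σ} e (var v) d with σ v in q
    substitute-mono e (var v) refl | just u = cong (Maybe.map var) (e v q)
    substitute-mono {σ = σ} e (op f ts) d with substitutes σ ts in q
    substitute-mono e (op f ts) refl | just ts′ =
      cong (Maybe.map (op f)) (substitutes-mono e ts q)

    substitutes-mono : {σ : X → Maybe Y} {τ : X → Maybe Z} {g : Y → Z} →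
                       (∀ v {u} → σ v ≡ just u → τ v ≡ just (g u)) →
                       (ts : Vec (Term X) n) {ts′ : Vec (Term Y) n} →
                       substitutes σ ts ≡ just ts′ → substitutes τ ts ≡ just (mapTerms g ts′)
    substitutes-mono e [] refl = refl
    substitutes-mono {σ = σ} e (t ∷ ts) d with substitute σ t in q | substitutes σ ts in q′
    substitutes-mono e (t ∷ ts) refl | just t′ | just ts′ =
      cong₂ (Maybe.zipWith _∷_) (substitute-mono e t q) (substitutes-mono e ts q′)

  -- Functor laws for `Cod` and `Arg`

  mapCod-id : (c : Cod X) → mapCod id c ≡ c
  mapCod-id (s , inj₁ t)  = cong (λ t → s , inj₁ t) (mapTerm-id t)
  mapCod-id (s , inj₂ tt) = refl

  mapCod-cong : {g h : X → Y} → (∀ v → g v ≡ h v) →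
                (c : Cod X) → mapCod g c ≡ mapCod h c
  mapCod-cong e (s , inj₁ t)  = cong (λ t → s , inj₁ t) (mapTerm-cong e t)
  mapCod-cong e (s , inj₂ tt) = refl

  mapCod-∘ : (g : Y → Z) (h : X → Y) (c : Cod X) →
             mapCod (g ∘ h) c ≡ mapCod g (mapCod h c)
  mapCod-∘ g h (s , inj₁ t)  = cong (λ t → s , inj₁ t) (mapTerm-∘ g h t)
  mapCod-∘ g h (s , inj₂ tt) = refl

  mapArg-id : (a : Arg X) → mapArg id a ≡ a
  mapArg-id (v , s , inj₁ u)  = refl
  mapArg-id (v , s , inj₂ tt) = refl

  mapArg-∘ : (g : Y → Z) (h : X → Y) (a : Arg X) →
             mapArg (g ∘ h) a ≡ mapArg g (mapArg h a)
  mapArg-∘ g h (v , s , inj₁ u)  = refl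
  mapArg-∘ g h (v , s , inj₂ tt) = refl

  mapArgs-∘ : (g : Y → Z) (h : X → Y) (as : Vec (Arg X) n) →
              Vec.map (mapArg (g ∘ h)) as ≡ Vec.map (mapArg g) (Vec.map (mapArg h) as)
  mapArgs-∘ g h as = trans (map-cong (mapArg-∘ g h) as) (map-∘ (mapArg g) (mapArg h) as)

  -- Generic argument vectors

  -- The variables that a rule with progressing positions `W` may use: `x_j` for every position,
  -- `y_j` only for `j` in `W`.
  Slots : Subset n → Set
  Slots {n} W = Fin n ⊎ Elements W

  elementAt : (W : Subset n) → Fin n → Elements W ⊎ ⊤
  elementAt (_ ∷ W)     (suc j) = Sum.map (λ { (k , p) → suc k , there p }) id (elementAt W j)
  elementAt (true ∷ W)  zero    = inj₁ (zero , here)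
  elementAt (false ∷ W) zero    = inj₂ tt

  -- Membership at a given position has only one proof, so the proof found by `elementAt` is `p`.
  elementAt-∈ : {W : Subset n} {j : Fin n} (p : j ∈ˢ W) → elementAt W j ≡ inj₁ (j , p)
  elementAt-∈ here      = refl
  elementAt-∈ (there p) = cong (Sum.map _ id) (elementAt-∈ p)

  elementAt-if : (h : Fin n → X) (W : Subset n) (j : Fin n) →
                 Sum.map (h ∘ proj₁) id (elementAt W j) ≡
                 (if lookup W j then inj₁ (h j) else inj₂ tt)
  elementAt-if h (true ∷ W)  zero    = refl
  elementAt-if h (false ∷ W) zero    = refl
  elementAt-if h (_ ∷ W)     (suc j) with elementAt W j | elementAt-if (h ∘ suc) W j
  ... | inj₁ _ | e = e
  ... | inj₂ _ | e = e

  generic : Vec S n → (W : Subset n) → Vec (Arg (Slots W)) n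
  generic ss W = tabulate λ j → inj₁ j , lookup ss j , Sum.map inj₂ id (elementAt W j)

  lookup-generic : (g : Fin n ⊎ Elements W → X) (ss : Vec S n) (j : Fin n) →
                   lookup (Vec.map (mapArg g) (generic ss W)) j ≡
                   (g (inj₁ j) , lookup ss j , Sum.map (g ∘ inj₂) id (elementAt W j))
  lookup-generic {W = W} g ss j = trans (lookup-map j (mapArg g) (generic ss W))
    (trans (cong (mapArg g) (lookup∘tabulate _ j))
           (cong (λ w → g (inj₁ j) , lookup ss j , w) (fuse (elementAt W j))))
    where
    fuse : (w : Elements W ⊎ ⊤) → Sum.map g id (Sum.map inj₂ id w) ≡ Sum.map (g ∘ inj₂) id w
    fuse (inj₁ _) = refl
    fuse (inj₂ _) = refl

  states : Vec (Arg X) n → Vec S n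
  states = Vec.map (proj₁ ∘ proj₂)

  progresses : X ⊎ ⊤ → Bool
  progresses (inj₁ _) = true
  progresses (inj₂ _) = false

  progressSet : Vec (Arg X) n → Subset n
  progressSet = Vec.map (progresses ∘ proj₂ ∘ proj₂)

  -- The proof `here` forces the head to be progressing, so no default value is needed for
  -- terminated positions.
  successor : (as : Vec (Arg X) n) {j : Fin n} → j ∈ˢ progressSet as → X
  successor ((_ , _ , inj₁ u) ∷ as) here      = u
  successor (_ ∷ as)                (there p) = successor as p

  lookup-successor : (as : Vec (Arg X) n) {j : Fin n} (p : j ∈ˢ progressSet as) →
                     proj₂ (proj₂ (lookup as j)) ≡ inj₁ (successor as p)
  lookup-successor ((_ , _ , inj₁ u) ∷ as) here      = refl
  lookup-successor ((_ , _ , inj₁ _) ∷ as) (there p) = lookup-successor as p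
  lookup-successor ((_ , _ , inj₂ _) ∷ as) (there p) = lookup-successor as p

  valuation : (as : Vec (Arg X) n) → Slots (progressSet as) → X
  valuation as (inj₁ j)       = proj₁ (lookup as j)
  valuation as (inj₂ (_ , p)) = successor as p

  elementAt-successor : (as : Vec (Arg X) n) (j : Fin n) →
                        Sum.map (valuation as ∘ inj₂) id (elementAt (progressSet as) j) ≡
                        proj₂ (proj₂ (lookup as j))
  elementAt-successor ((_ , _ , inj₁ _) ∷ as) zero = refl
  elementAt-successor ((_ , _ , inj₂ _) ∷ as) zero = refl
  -- The cases for `suc` repeat one argument; the head is split because `successor` inspects it
  -- before the membership proof.
  elementAt-successor ((_ , _ , inj₁ _) ∷ as) (suc j)
    with elementAt (progressSet as) j | elementAt-successor as j
  ... | inj₁ _ | e = e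
  ... | inj₂ _ | e = e
  elementAt-successor ((_ , _ , inj₂ _) ∷ as) (suc j)
    with elementAt (progressSet as) j | elementAt-successor as j
  ... | inj₁ _ | e = e
  ... | inj₂ _ | e = e

  -- Existence of the representation by a generic vector, checked position by position.
  generic-valuation : (as : Vec (Arg X) n) →
    Vec.map (mapArg (valuation as)) (generic (states as) (progressSet as)) ≡ as
  generic-valuation as = lookup-ext λ j →
    trans (lookup-generic (valuation as) (states as) j)
          (cong₂ (λ s w → proj₁ (lookup as j) , s , w)
                 (lookup-map j (proj₁ ∘ proj₂) as) (elementAt-successor as j))

  progresses-elementAt : (k : Elements W → X) (j : Fin n) →
                         progresses (Sum.map k id (elementAt {n} W j)) ≡ lookup W j
  progresses-elementAt {W = true ∷ W}  k zero    = refl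
  progresses-elementAt {W = false ∷ W} k zero    = refl
  progresses-elementAt {W = _ ∷ W}     k (suc j)
    with elementAt W j | progresses-elementAt {W = W} (k ∘ (λ { (i , p) → suc i , there p })) j
  ... | inj₁ _ | e = e
  ... | inj₂ _ | e = e

  -- With the next two lemmas, and `lookup-generic` for the slots `inj₁ j`, this gives uniqueness of
  -- the representation: outputs, progressing set and valuation can be read off the mapped vector.
  states-generic : (g : Fin n ⊎ Elements W → X) (ss : Vec S n) →
                   states (Vec.map (mapArg g) (generic ss W)) ≡ ss
  states-generic g ss = lookup-ext λ j →
    trans (lookup-map j _ (Vec.map (mapArg g) (generic ss _)))
          (cong (proj₁ ∘ proj₂) (lookup-generic g ss j))

  progressSet-generic : (g : Fin n ⊎ Elements W → X) (ss : Vec S n) →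
                        progressSet (Vec.map (mapArg g) (generic ss W)) ≡ W
  progressSet-generic g ss = lookup-ext λ j →
    trans (lookup-map j _ (Vec.map (mapArg g) (generic ss _)))
          (trans (cong (progresses ∘ proj₂ ∘ proj₂) (lookup-generic g ss j))
                 (progresses-elementAt (g ∘ inj₂) j))

  -- The sets containing `j` are only propositionally equal, so `p` and `q` are independent; both
  -- sides are the last component at position `j`.
  successor-generic : (g : Fin n ⊎ Elements W → X) (ss : Vec S n) {j : Fin n}
    (p : j ∈ˢ progressSet (Vec.map (mapArg g) (generic ss W))) (q : j ∈ˢ W) →
    successor (Vec.map (mapArg g) (generic ss W)) p ≡ g (inj₂ (j , q))
  successor-generic g ss {j} p q = inj₁-injective
    (trans (sym (lookup-successor _ p))
           (trans (cong (proj₂ ∘ proj₂) (lookup-generic g ss j))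
                  (cong (Sum.map (g ∘ inj₂) id) (elementAt-∈ q))))

  -- Laws and families

  -- With `fromCod`, the distributivity bijection between `S × T + S`, the form used by families,
  -- and `S × (T + 1)`, the form used by laws.
  toCod : (S × Term X) ⊎ S → Cod X
  toCod (inj₁ (s , t)) = s , inj₁ t
  toCod (inj₂ s)       = s , inj₂ tt

  fromCod : Cod X → (S × Term X) ⊎ S
  fromCod (s , inj₁ t) = inj₁ (s , t)
  fromCod (s , inj₂ _) = inj₂ s

  toCod-fromCod : (c : Cod X) → toCod (fromCod c) ≡ c
  toCod-fromCod (s , inj₁ t)  = refl
  toCod-fromCod (s , inj₂ tt) = refl

  fromCod-toCod : (c : (S × Term X) ⊎ S) → fromCod (toCod c) ≡ c
  fromCod-toCod (inj₁ _) = refl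
  fromCod-toCod (inj₂ _) = refl

  familyOf : Law → Family
  familyOf d f W (s , ss) = fromCod (δ d (Slots W) (s , f , generic ss W))

  evaluate : Family → (X : Set) → Dom X → Cod X
  evaluate r X (s , f , as) =
    mapCod (valuation as) (toCod (r f (progressSet as) (s , states as)))

  -- The type of `r f W` depends on `W`. Taking the equations as arguments between free variables
  -- lets them be matched with `refl`, so no transport of terms along `W′ ≡ W` appears.
  reindex : (r : Family) (f : Op) {s : S} {ss ss′ : Vec S (ar f)} {W W′ : Subset (ar f)}
            (g : Slots W → X) (g′ : Slots W′ → X) →
            ss′ ≡ ss → W′ ≡ W →
            (∀ j → g′ (inj₁ j) ≡ g (inj₁ j)) →
            (∀ {j} p q → g′ (inj₂ (j , p)) ≡ g (inj₂ (j , q))) →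
            mapCod g′ (toCod (r f W′ (s , ss′))) ≡ mapCod g (toCod (r f W (s , ss)))
  reindex r f g g′ refl refl e₁ e₂ =
    mapCod-cong (λ { (inj₁ j) → e₁ j ; (inj₂ (j , p)) → e₂ p p }) (toCod (r f _ _))

  evaluate-generic : (r : Family) (f : Op) (s : S) (ss : Vec S (ar f)) (W : Subset (ar f))
                     (g : Slots W → X) →
                     evaluate r X (s , f , Vec.map (mapArg g) (generic ss W)) ≡
                     mapCod g (toCod (r f W (s , ss)))
  evaluate-generic r f s ss W g =
    reindex r f g (valuation (Vec.map (mapArg g) (generic ss W)))
      (states-generic g ss) (progressSet-generic g ss)
      (λ j → cong proj₁ (lookup-generic g ss j)) (successor-generic g ss)

  -- Once `as` is written as a generic vector mapped along its valuation `v`, both sides are the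
  -- same generic value mapped along `g ∘ v`.
  evaluate-natural : (r : Family) (g : X → Y) (z : Dom X) →
                     evaluate r Y (mapDom g z) ≡ mapCod g (evaluate r X z)
  evaluate-natural {Y = Y} r g (s , f , as) = begin
    evaluate r Y (s , f , Vec.map (mapArg g) as)
      ≡⟨ cong (λ bs → evaluate r Y (s , f , Vec.map (mapArg g) bs)) (sym (generic-valuation as)) ⟩
    evaluate r Y (s , f , Vec.map (mapArg g) (Vec.map (mapArg v) as₀))
      ≡⟨ cong (λ bs → evaluate r Y (s , f , bs)) (sym (mapArgs-∘ g v as₀)) ⟩
    evaluate r Y (s , f , Vec.map (mapArg (g ∘ v)) as₀)
      ≡⟨ evaluate-generic r f s (states as) (progressSet as) (g ∘ v) ⟩
    mapCod (g ∘ v) c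
      ≡⟨ mapCod-∘ g v c ⟩
    mapCod g (mapCod v c) ∎
    where
    open ≡-Reasoning
    v = valuation as
    as₀ = generic (states as) (progressSet as)
    c = toCod (r f (progressSet as) (s , states as))

  lawOfFamily : Family → Law
  lawOfFamily r = record { δ = evaluate r ; natural = evaluate-natural r }

  -- This is naturality of `d` at the valuation of `as`.
  evaluate-familyOf : (d : Law) (X : Set) (z : Dom X) → evaluate (familyOf d) X z ≡ δ d X z
  evaluate-familyOf d X (s , f , as) = begin
    mapCod v (toCod (fromCod (δ d _ (s , f , as₀))))
      ≡⟨ cong (mapCod v) (toCod-fromCod (δ d _ (s , f , as₀))) ⟩
    mapCod v (δ d _ (s , f , as₀))
      ≡⟨ sym (natural d v (s , f , as₀)) ⟩
    δ d X (s , f , Vec.map (mapArg v) as₀)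
      ≡⟨ cong (λ bs → δ d X (s , f , bs)) (generic-valuation as) ⟩
    δ d X (s , f , as) ∎
    where
    open ≡-Reasoning
    v = valuation as
    as₀ = generic (states as) (progressSet as)

  familyOf-lawOfFamily : (r : Family) → Setoid._≈_ families (familyOf (lawOfFamily r)) r
  familyOf-lawOfFamily r f W (s , ss) = begin
    fromCod (evaluate r _ (s , f , generic ss W))
      -- The identity is inserted to reach the form of `evaluate-generic`, with valuation `id`.
      ≡⟨ cong (λ bs → fromCod (evaluate r _ (s , f , bs)))
              (sym (trans (map-cong mapArg-id (generic ss W)) (map-id (generic ss W)))) ⟩
    fromCod (evaluate r _ (s , f , Vec.map (mapArg id) (generic ss W)))
      ≡⟨ cong fromCod (evaluate-generic r f s ss W id) ⟩
    fromCod (mapCod id (toCod (r f W (s , ss))))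
      ≡⟨ cong fromCod (mapCod-id _) ⟩
    fromCod (toCod (r f W (s , ss)))
      ≡⟨ fromCod-toCod _ ⟩
    r f W (s , ss) ∎
    where open ≡-Reasoning

  laws↔families : Inverse laws families
  laws↔families = record
    { to        = familyOf
    ; from      = lawOfFamily
    ; to-cong   = λ {d} {d′} → to-cong {d} {d′}
    ; from-cong = λ {r} {r′} → from-cong {r} {r′}
    ; inverse   =
        (λ {r} {d} e f W z →
          trans (to-cong {d} {lawOfFamily r} e f W z) (familyOf-lawOfFamily r f W z))
      , (λ {d} {r} e X z →
          trans (from-cong {r} {familyOf d} e X z) (evaluate-familyOf d X z))
    }
    where
    module L = Setoid laws
    module F = Setoid families

    to-cong : {d d′ : Law} → d L.≈ d′ → familyOf d F.≈ familyOf d′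
    to-cong e f W (s , ss) = cong fromCod (e (Slots W) (s , f , generic ss W))

    from-cong : {r r′ : Family} → r F.≈ r′ → lawOfFamily r L.≈ lawOfFamily r′
    from-cong e X (s , f , as) =
      cong (mapCod (valuation as) ∘ toCod) (e f (progressSet as) (s , states as))

  -- Specifications and laws

  modeIf : Bool → Mode
  modeIf b = if b then pr else te

  isPr : Mode → Bool
  isPr pr = true
  isPr te = false

  modeIf-isPr : (m : Mode) → modeIf (isPr m) ≡ m
  modeIf-isPr pr = refl
  modeIf-isPr te = refl

  isPr-modeIf : (b : Bool) → isPr (modeIf b) ≡ b
  isPr-modeIf true  = refl
  isPr-modeIf false = refl

  modeIf-progresses : (w : X ⊎ ⊤) → modeIf (progresses w) ≡ modeOf w
  modeIf-progresses (inj₁ _) = refl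
  modeIf-progresses (inj₂ _) = refl

  modeOf-pr : (w : X ⊎ ⊤) → modeOf w ≡ pr → ∃ λ u → w ≡ inj₁ u
  modeOf-pr (inj₁ u) _ = u , refl

  mode-target : (l : Literal) {q : Term 𝒱} → target l ≡ just q → mode l ≡ pr
  mode-target (_ , _ ⟶ _ , _) _ = refl

  -- Coordinates on triggers, the same data that index `ruleOf`. Injectivity and surjectivity below
  -- yield exactly one rule of a law per trigger.
  triggerWith : S → Vec S n → Subset n → Trigger n
  triggerWith s ss W = s , tabulate λ j → lookup ss j , modeIf (lookup W j)

  triggerWith-injective : {s s′ : S} {ss ss′ : Vec S n} {W W′ : Subset n} →
    triggerWith s ss W ≡ triggerWith s′ ss′ W′ → s ≡ s′ × ss ≡ ss′ × W ≡ W′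
  triggerWith-injective {W = W} {W′} e =
    cong proj₁ e
    , lookup-ext (λ j → cong proj₁ (entries j))
    , lookup-ext (λ j → trans (sym (isPr-modeIf (lookup W j)))
        (trans (cong (isPr ∘ proj₂) (entries j)) (isPr-modeIf (lookup W′ j))))
    where
    entries : ∀ j → _ ≡ _
    entries j = trans (sym (lookup∘tabulate _ j))
      (trans (cong (λ τ → lookup (proj₂ τ) j) e) (lookup∘tabulate _ j))

  triggerWith-surjective : (τ : Trigger n) →
    triggerWith (proj₁ τ) (Vec.map proj₁ (proj₂ τ)) (Vec.map (isPr ∘ proj₂) (proj₂ τ)) ≡ τ
  triggerWith-surjective (s , ms) = cong (s ,_) (lookup-ext λ j →
    trans (lookup∘tabulate _ j)
      (cong₂ _,_ (lookup-map j proj₁ ms)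
        (trans (cong modeIf (lookup-map j (isPr ∘ proj₂) ms)) (modeIf-isPr _))))

  triggerOf-triggerWith : (s : S) (as : Vec (Arg X) n) →
                          triggerOf s as ≡ triggerWith s (states as) (progressSet as)
  triggerOf-triggerWith s as = cong (s ,_) (lookup-ext λ j →
    trans (lookup-map j _ as) (sym (trans (lookup∘tabulate _ j)
      (cong₂ _,_ (lookup-map j _ as)
        (trans (cong modeIf (lookup-map j _ as))
               (modeIf-progresses (proj₂ (proj₂ (lookup as j)))))))))

  -- The entries of `premissesOf` with the Boolean isolated, so that their properties follow by
  -- cases on it.
  premiss : S → ℕ → S → Bool → Literal
  premiss s i s′ b = if b then s , var (x i) ⟶ s′ , var (y i) else s , var (x i) ↓ s′

  trigger-premiss : (s : S) (i : ℕ) (s′ : S) (b : Bool) →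
    (output (premiss s i s′ b) , mode (premiss s i s′ b)) ≡ (s′ , modeIf b)
  trigger-premiss s i s′ true  = refl
  trigger-premiss s i s′ false = refl

  input-premiss : (s : S) (i : ℕ) (s′ : S) (b : Bool) → input (premiss s i s′ b) ≡ s
  input-premiss s i s′ true  = refl
  input-premiss s i s′ false = refl

  source-premiss : (s : S) (i : ℕ) (s′ : S) (b : Bool) →
                   source (premiss s i s′ b) ≡ var (x i)
  source-premiss s i s′ true  = refl
  source-premiss s i s′ false = refl

  target-premiss : (s : S) (i : ℕ) (s′ : S) (b : Bool) {q : Term 𝒱} →
                   target (premiss s i s′ b) ≡ just q → q ≡ var (y i)
  target-premiss s i s′ true refl = refl

  -- The conditions on a rule leave only the output and the mode of a premiss free, and these are
  -- recorded in the trigger.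
  premiss-complete : {s : S} {i : ℕ} (l : Literal) → input l ≡ s → source l ≡ var (x i) →
                     (∀ {q} → target l ≡ just q → q ≡ var (y i)) →
                     l ≡ premiss s i (output l) (isPr (mode l))
  premiss-complete (s , _ ⟶ s′ , q) refl refl e = cong (s , _ ⟶ s′ ,_) (e refl)
  premiss-complete (s , _ ↓ s′)     refl refl e = refl

  -- `conclusionOf` as a function of the value of the law, so that equations between values carry
  -- over to conclusions.
  conclusionFrom : Op → S → Cod 𝒱 → Literal
  conclusionFrom f s (s′ , inj₁ t)  = s , f⟨x⟩ f ⟶ s′ , t
  conclusionFrom f s (s′ , inj₂ tt) = s , f⟨x⟩ f ↓ s′

  input-conclusionFrom : (f : Op) (s : S) (c : Cod 𝒱) → input (conclusionFrom f s c) ≡ s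
  input-conclusionFrom f s (s′ , inj₁ t)  = refl
  input-conclusionFrom f s (s′ , inj₂ tt) = refl

  source-conclusionFrom : (f : Op) (s : S) (c : Cod 𝒱) →
                          source (conclusionFrom f s c) ≡ f⟨x⟩ f
  source-conclusionFrom f s (s′ , inj₁ t)  = refl
  source-conclusionFrom f s (s′ , inj₂ tt) = refl

  target-conclusionFrom : (f : Op) (s : S) (g : X → 𝒱) (c : Cod X) {q : Term 𝒱} →
                          target (conclusionFrom f s (mapCod g c)) ≡ just q →
                          ∃ λ t → q ≡ mapTerm g t
  target-conclusionFrom f s g (s′ , inj₁ t) refl = t , refl

  slotVar : {W : Subset n} → Slots W → 𝒱
  slotVar (inj₁ j)       = x (toℕ j)
  slotVar (inj₂ (j , _)) = y (toℕ j)

  -- The partial assignment of an argument vector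

  lookupℕ-toℕ : {A : Set} (as : Vec A n) (j : Fin n) → lookupℕ as (toℕ j) ≡ just (lookup as j)
  lookupℕ-toℕ (a ∷ as) zero    = refl
  lookupℕ-toℕ (a ∷ as) (suc j) = lookupℕ-toℕ as j

  lookupℕ-map : {A B : Set} (g : A → B) (as : Vec A n) (i : ℕ) →
                lookupℕ (Vec.map g as) i ≡ Maybe.map g (lookupℕ as i)
  lookupℕ-map g []       i       = refl
  lookupℕ-map g (a ∷ as) zero    = refl
  lookupℕ-map g (a ∷ as) (suc i) = lookupℕ-map g as i

  assign-x : (as : Vec (Arg X) n) (j : Fin n) →
             assign as (x (toℕ j)) ≡ just (proj₁ (lookup as j))
  assign-x as j = cong (Maybe.map proj₁) (lookupℕ-toℕ as j)

  assign-y : (as : Vec (Arg X) n) (j : Fin n) {u : X} →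
             proj₂ (proj₂ (lookup as j)) ≡ inj₁ u → assign as (y (toℕ j)) ≡ just u
  assign-y as j e rewrite lookupℕ-toℕ as j | e = refl

  assign-x⁻¹ : (as : Vec (Arg X) n) (i : ℕ) {u : X} → assign as (x i) ≡ just u →
               ∃ λ j → i ≡ toℕ j × proj₁ (lookup as j) ≡ u
  assign-x⁻¹ (a ∷ as) zero    refl = zero , refl , refl
  assign-x⁻¹ (a ∷ as) (suc i) e with assign-x⁻¹ as i e
  ... | j , i≡ , e′ = suc j , cong suc i≡ , e′

  assign-y⁻¹ : (as : Vec (Arg X) n) (i : ℕ) {u : X} → assign as (y i) ≡ just u →
               ∃ λ j → i ≡ toℕ j × proj₂ (proj₂ (lookup as j)) ≡ inj₁ u
  assign-y⁻¹ ((_ , _ , inj₁ _) ∷ as) zero    refl = zero , refl , refl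
  assign-y⁻¹ (a ∷ as)                (suc i) e with assign-y⁻¹ as i e
  ... | j , i≡ , e′ = suc j , cong suc i≡ , e′

  -- Links named variables to slots: along `slotVar` the partial assignment is total and is the
  -- valuation.
  assign-slotVar : (as : Vec (Arg X) n) (u : Slots (progressSet as)) →
                   assign as (slotVar u) ≡ just (valuation as u)
  assign-slotVar as (inj₁ j)       = assign-x as j
  assign-slotVar as (inj₂ (j , p)) = assign-y as j (lookup-successor as p)

  assign-map : (g : X → Y) (as : Vec (Arg X) n) (v : 𝒱) {u : X} →
               assign as v ≡ just u → assign (Vec.map (mapArg g) as) v ≡ just (g u)
  assign-map g as (x i) e rewrite lookupℕ-map (mapArg g) as i with lookupℕ as i
  assign-map g as (x i) refl | just _ = refl
  assign-map g as (y i) e rewrite lookupℕ-map (mapArg g) as i with lookupℕ as i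
  assign-map g as (y i) refl | just (_ , _ , inj₁ _) = refl

  -- The law of a specification

  value-functional : {as : Vec (Arg X) n} {l : Literal} {c c′ : Cod X} →
                     Value as l c → Value as l c′ → c ≡ c′
  value-functional terminating     terminating      = refl
  value-functional (progressing e) (progressing e′) =
    cong (λ t → _ , inj₁ t) (just-injective (trans (sym e) e′))

  value-natural : (g : X → Y) {as : Vec (Arg X) n} {l : Literal} {c : Cod X} →
                  Value as l c → Value (Vec.map (mapArg g) as) l (mapCod g c)
  value-natural g      terminating = terminating
  value-natural g {as} (progressing {t = t} e) =
    progressing (substitute-mono (assign-map g as) t e)

  -- A variable of the target is some `x_j`, which always has a value, or the target `y_j` of a
  -- progressing premiss; in the latter case equality of the triggers makes `w_j` an element of `X`.
  value-exists : {f : Op} {r : RuleExpr (ar f)} {s : S} {as : Vec (Arg X) (ar f)} →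
                 IsRule f r → trigger r ≡ triggerOf s as → ∃ (Value as (conclusion r))
  value-exists {r = ps / (_ , _ ↓ s′)} ρ e = (s′ , inj₂ tt) , terminating
  value-exists {X = X} {r = ps / (_ , _ ⟶ s′ , t)} {as = as} ρ e =
    (s′ , inj₁ (proj₁ total)) , progressing (proj₂ total)
    where
    open IsRule ρ

    modes : ∀ j → mode (lookup ps j) ≡ modeOf (proj₂ (proj₂ (lookup as j)))
    modes j = cong proj₂ (trans (sym (lookup-map j _ ps))
      (trans (cong (λ τ → lookup (proj₂ τ) j) e) (lookup-map j _ as)))

    defined : ∀ {v} → v occursIn t → ∃ λ u → assign as v ≡ just u
    defined o with conclusionTarget refl o
    ... | j , inj₁ e′ with trans (sym e′) (premissSource j)
    ...   | refl = _ , assign-x as j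
    defined o | j , inj₂ e′ with premissTarget j e′
    ...   | refl with modeOf-pr _ (trans (sym (modes j)) (mode-target (lookup ps j) e′))
    ...     | u , e″ = u , assign-y as j e″

    total : ∃ λ t′ → substitute (assign as) t ≡ just t′
    total = substitute-total t defined

  ruleFor : (L : Specification) (f : Op) → Trigger (ar f) → RuleExpr (ar f)
  ruleFor L f τ = proj₁ (unique L f τ)

  ruleFor-∈ : (L : Specification) (f : Op) (τ : Trigger (ar f)) → ruleFor L f τ ∈ rules L f
  ruleFor-∈ L f τ = proj₁ (proj₁ (proj₂ (unique L f τ)))

  trigger-ruleFor : (L : Specification) (f : Op) (τ : Trigger (ar f)) →
                    trigger (ruleFor L f τ) ≡ τ
  trigger-ruleFor L f τ = proj₂ (proj₁ (proj₂ (unique L f τ)))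

  ruleFor-unique : (L : Specification) (f : Op) (τ : Trigger (ar f)) {r : RuleExpr (ar f)} →
                   r ∈ rules L f → trigger r ≡ τ → ruleFor L f τ ≡ r
  ruleFor-unique L f τ r∈ e = proj₂ (proj₂ (unique L f τ)) (r∈ , e)

  outcome : (L : Specification) (s : S) (f : Op) (as : Vec (Arg X) (ar f)) →
            ∃ (Value as (conclusion (ruleFor L f (triggerOf s as))))
  outcome L s f as = value-exists (isRule L f (ruleFor-∈ L f _)) (trigger-ruleFor L f _)

  value-outcome : (L : Specification) (s : S) (f : Op) (as : Vec (Arg X) (ar f)) →
                  ∀ r → r ∈ rules L f → trigger r ≡ triggerOf s as →
                  Value as (conclusion r) (proj₁ (outcome L s f as))
  value-outcome L s f as r r∈ e =
    subst (λ r → Value as (conclusion r) _) (ruleFor-unique L f _ r∈ e) (proj₂ (outcome L s f as))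

  triggerOf-map : (g : X → Y) (s : S) (as : Vec (Arg X) n) →
                  triggerOf s (Vec.map (mapArg g) as) ≡ triggerOf s as
  triggerOf-map g s as = cong (s ,_) (trans (sym (map-∘ _ (mapArg g) as)) (map-cong
    (λ { (_ , _ , inj₁ _) → refl ; (_ , _ , inj₂ _) → refl }) as))

  lawOf : Specification → Law
  lawOf L = record
    { δ       = λ { X (s , f , as) → proj₁ (outcome L s f as) }
    -- Mapping leaves the trigger unchanged, so the rule chosen for `as` also computes the value at
    -- the mapped vector.
    ; natural = λ { g (s , f , as) → value-functional
        (value-outcome L s f (Vec.map (mapArg g) as)
          (ruleFor L f (triggerOf s as)) (ruleFor-∈ L f _)
          (trans (trigger-ruleFor L f _) (sym (triggerOf-map g s as))))
        (value-natural g (proj₂ (outcome L s f as))) }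
    }

  isLawOf-lawOf : (L : Specification) → IsLawOf L (lawOf L)
  isLawOf-lawOf L X s f as = value-outcome L s f as

  -- The rule of `L` for the given trigger is also a rule of `L′`, and its conclusion has at most
  -- one value.
  isLawOf-cong : {L L′ : Specification} {d d′ : Law} → Setoid._≈_ specifications L L′ →
                 IsLawOf L d → IsLawOf L′ d′ → Setoid._≈_ laws d d′
  isLawOf-cong {L} L≈L′ ℓ ℓ′ X (s , f , as) = value-functional
    (ℓ X s f as r (ruleFor-∈ L f _) (trigger-ruleFor L f _))
    (ℓ′ X s f as r (proj₁ (L≈L′ f) (ruleFor-∈ L f _)) (trigger-ruleFor L f _))
    where r = ruleFor L f (triggerOf s as)

  -- The specification of a law

  module _ (d : Law) (f : Op) (s : S) (ss : Vec S (ar f)) (W : Subset (ar f)) where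

    lookup-argsOf : (j : Fin (ar f)) → lookup (argsOf d f s ss W) j ≡
      (x (toℕ j) , lookup ss j , (if lookup W j then inj₁ (y (toℕ j)) else inj₂ tt))
    lookup-argsOf j = lookup∘tabulate _ j

    -- Makes naturality along `slotVar` applicable to the arguments from which the rules of `d` are
    -- read.
    argsOf-generic : argsOf d f s ss W ≡ Vec.map (mapArg slotVar) (generic ss W)
    argsOf-generic = lookup-ext λ j → trans (lookup-argsOf j)
      (sym (trans (lookup-generic slotVar ss j)
                  (cong (λ w → x (toℕ j) , lookup ss j , w) (elementAt-if (y ∘ toℕ) W j))))

    triggerOf-argsOf : triggerOf s (argsOf d f s ss W) ≡ triggerWith s ss W
    triggerOf-argsOf = trans (cong (triggerOf s) argsOf-generic)
      (trans (triggerOf-triggerWith s _)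
             (cong₂ (triggerWith s) (states-generic slotVar ss) (progressSet-generic slotVar ss)))

    -- Each `x_j`, and each `y_j` with `j` in `W`, stands in its own place in `argsOf`.
    assign-argsOf : (v : 𝒱) {u : 𝒱} → assign (argsOf d f s ss W) v ≡ just u → v ≡ u
    assign-argsOf (x i) e with assign-x⁻¹ (argsOf d f s ss W) i e
    ... | j , refl , e′ = trans (sym (cong proj₁ (lookup-argsOf j))) e′
    assign-argsOf (y i) e with assign-y⁻¹ (argsOf d f s ss W) i e
    ... | j , refl , e′ =
      successor≡ (lookup W j) (trans (sym (cong (proj₂ ∘ proj₂) (lookup-argsOf j))) e′)
      where
      successor≡ : (b : Bool) {u v : 𝒱} → (if b then inj₁ v else inj₂ tt) ≡ inj₁ u → v ≡ u
      successor≡ true refl = refl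

    conclusionOf-conclusionFrom :
      conclusionOf d f s ss W ≡ conclusionFrom f s (δ d 𝒱 (s , f , argsOf d f s ss W))
    conclusionOf-conclusionFrom with δ d 𝒱 (s , f , argsOf d f s ss W)
    ... | s′ , inj₁ t  = refl
    ... | s′ , inj₂ tt = refl

    conclusionOf-generic : conclusionOf d f s ss W ≡
      conclusionFrom f s (mapCod slotVar (δ d (Slots W) (s , f , generic ss W)))
    conclusionOf-generic = trans conclusionOf-conclusionFrom (cong (conclusionFrom f s)
      (trans (cong (λ as → δ d 𝒱 (s , f , as)) argsOf-generic) (natural d slotVar _)))

    lookup-premissesOf : (j : Fin (ar f)) →
      lookup (premissesOf d f s ss W) j ≡ premiss s (toℕ j) (lookup ss j) (lookup W j)
    lookup-premissesOf j = lookup∘tabulate _ j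

    trigger-ruleOf : trigger (ruleOf d f s ss W) ≡ triggerWith s ss W
    trigger-ruleOf = cong₂ _,_
      (trans (cong input conclusionOf-conclusionFrom)
             (input-conclusionFrom f s (δ d 𝒱 (s , f , argsOf d f s ss W))))
      (lookup-ext λ j → trans (lookup-map j _ (premissesOf d f s ss W))
        (trans (cong (λ l → output l , mode l) (lookup-premissesOf j))
          (trans (trigger-premiss s (toℕ j) (lookup ss j) (lookup W j))
                 (sym (lookup∘tabulate _ j)))))

    isRule-ruleOf : IsRule f (ruleOf d f s ss W)
    isRule-ruleOf = record
      { sameInput        = λ j →
          trans (cong input (lookup-premissesOf j))
                (trans (input-premiss s (toℕ j) (lookup ss j) (lookup W j))
                       (sym (cong proj₁ trigger-ruleOf)))
      ; premissSource    = premissSource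
      ; premissTarget    = λ j e → target-premiss s (toℕ j) (lookup ss j) (lookup W j)
          (trans (sym (cong target (lookup-premissesOf j))) e)
      ; conclusionSource =
          trans (cong source conclusionOf-conclusionFrom)
                (source-conclusionFrom f s (δ d 𝒱 (s , f , argsOf d f s ss W)))
      ; conclusionTarget = conclusionTarget
      }
      where
      premissSource : ∀ j → source (lookup (premissesOf d f s ss W) j) ≡ var (x (toℕ j))
      premissSource j = trans (cong source (lookup-premissesOf j))
        (source-premiss s (toℕ j) (lookup ss j) (lookup W j))

      slot-occurs : (u : Slots W) → ∃ λ j →
        source (lookup (premissesOf d f s ss W) j) ≡ var (slotVar u) ⊎
        target (lookup (premissesOf d f s ss W) j) ≡ just (var (slotVar u))
      slot-occurs (inj₁ j)       = j , inj₁ (premissSource j)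
      slot-occurs (inj₂ (j , p)) = j , inj₂ (trans (cong target (lookup-premissesOf j))
        (cong (λ b → target (premiss s (toℕ j) (lookup ss j) b)) ([]=⇒lookup p)))

      conclusionTarget : ∀ {q v} → target (conclusionOf d f s ss W) ≡ just q → v occursIn q →
        ∃ λ j → source (lookup (premissesOf d f s ss W) j) ≡ var v
              ⊎ target (lookup (premissesOf d f s ss W) j) ≡ just (var v)
      -- The target is a term over slots renamed by `slotVar`, so `v` is the name of a slot, and
      -- every slot is the source or the target of a premiss.
      conclusionTarget e o =
        let t , q≡ = target-conclusionFrom f s slotVar (δ d (Slots W) (s , f , generic ss W))
                       (trans (sym (cong target conclusionOf-generic)) e)
            u , v≡ = occursIn-mapTerm slotVar t (subst (_ occursIn_) q≡ o)
        in subst (λ v → ∃ λ j → source (lookup (premissesOf d f s ss W) j) ≡ var v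
                              ⊎ target (lookup (premissesOf d f s ss W) j) ≡ just (var v))
                 (sym v≡) (slot-occurs u)

    -- Substituting along `argsOf` fixes every variable that has a value, so the value of a literal
    -- already contains its target.
    conclusionFrom-value : {l : Literal} {c : Cod 𝒱} → Value (argsOf d f s ss W) l c →
                           input l ≡ s → source l ≡ f⟨x⟩ f → l ≡ conclusionFrom f s c
    conclusionFrom-value terminating refl refl = refl
    conclusionFrom-value (progressing {s′ = s′} {t = t} {t′} e) refl refl =
      cong (s , f⟨x⟩ f ⟶ s′ ,_) (trans t≡ (mapTerm-id t′))
      where
      t≡ : t ≡ mapTerm id t′
      t≡ = just-injective (trans (sym (substitute-just t))
        (substitute-mono {τ = just} (λ v e → cong just (assign-argsOf v e)) t e))

  ruleOf-cong : (d : Law) (f : Op) {s s′ : S} {ss ss′ : Vec S (ar f)} {W W′ : Subset (ar f)} →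
                s ≡ s′ × ss ≡ ss′ × W ≡ W′ → ruleOf d f s ss W ≡ ruleOf d f s′ ss′ W′
  ruleOf-cong d f (refl , refl , refl) = refl

  -- The trigger gives back the coordinates `s`, `ss`, `W` from which the rule is built.
  trigger-injective : (d : Law) (f : Op) {r r′ : RuleExpr (ar f)} →
                      r ∈ rulesOf d f → r′ ∈ rulesOf d f → trigger r ≡ trigger r′ → r ≡ r′
  trigger-injective d f (s , ss , W , refl) (s′ , ss′ , W′ , refl) e =
    ruleOf-cong d f (triggerWith-injective {ss = ss} {ss′} {W} {W′}
      (trans (sym (trigger-ruleOf d f s ss W)) (trans e (trigger-ruleOf d f s′ ss′ W′))))

  specificationOf : Law → Specification
  specificationOf d = record
    { rules  = rulesOf d
    ; isRule = λ { f (s , ss , W , refl) → isRule-ruleOf d f s ss W }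
    ; unique = λ f τ →
        let s  = proj₁ τ
            ss = Vec.map proj₁ (proj₂ τ)
            V  = Vec.map (isPr ∘ proj₂) (proj₂ τ)
            e  = trans (trigger-ruleOf d f s ss V) (triggerWith-surjective τ)
        in ruleOf d f s ss V , ((s , ss , V , refl) , e) ,
           λ { (r∈ , e′) → trigger-injective d f (s , ss , V , refl) r∈ (trans e (sym e′)) }
    }

  value-conclusionFrom : (f : Op) (s : S) (as : Vec (Arg X) n) (c : Cod (Slots (progressSet as))) →
    Value as (conclusionFrom f s (mapCod slotVar c)) (mapCod (valuation as) c)
  value-conclusionFrom f s as (s′ , inj₁ t)  = progressing (substitute-mapTerm (assign-slotVar as) t)
  value-conclusionFrom f s as (s′ , inj₂ tt) = terminating

  -- The conclusion of the rule and the value of `d` at `as` both come, by naturality, from the one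
  -- generic value `c`: the former along `slotVar`, the latter along the valuation.
  isLawOf-specificationOf : (d : Law) → IsLawOf (specificationOf d) d
  isLawOf-specificationOf d X s f as r r∈ e = subst (λ r → Value as (conclusion r) _) (sym r≡)
    (subst (Value as (conclusionOf d f s ss V)) δ≡
      (subst (λ l → Value as l (mapCod (valuation as) c)) (sym (conclusionOf-generic d f s ss V))
        (value-conclusionFrom f s as c)))
    where
    ss = states as
    V  = progressSet as
    c  = δ d (Slots V) (s , f , generic ss V)

    δ≡ : mapCod (valuation as) c ≡ δ d X (s , f , as)
    δ≡ = trans (sym (natural d (valuation as) (s , f , generic ss V)))
               (cong (λ bs → δ d X (s , f , bs)) (generic-valuation as))

    r≡ : r ≡ ruleOf d f s ss V
    r≡ = trigger-injective d f r∈ (s , ss , V , refl)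
      (trans e (trans (triggerOf-triggerWith s as) (sym (trigger-ruleOf d f s ss V))))

  -- The coordinates are read off the trigger of `r`. They fix the premisses by the conditions on
  -- rules, and the conclusion because its value at `argsOf`, which `d` computes, determines it.
  rules⊆rulesOf : {L : Specification} {d : Law} → IsLawOf L d →
                  ∀ f {r} → r ∈ rules L f → r ∈ rulesOf d f
  rules⊆rulesOf {L} {d} ℓ f {r} r∈ = s , ss , V , cong₂ _/_ premisses≡ conclusion≡
    where
    open IsRule (isRule L f r∈)
    s  = input (conclusion r)
    ss = Vec.map proj₁ (proj₂ (trigger r))
    V  = Vec.map (isPr ∘ proj₂) (proj₂ (trigger r))

    trigger≡ : trigger r ≡ triggerOf s (argsOf d f s ss V)
    trigger≡ = trans (sym (triggerWith-surjective (trigger r))) (sym (triggerOf-argsOf d f s ss V))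

    premisses≡ : premisses r ≡ premissesOf d f s ss V
    premisses≡ = lookup-ext λ j →
      trans (premiss-complete (lookup (premisses r) j)
              (sameInput j) (premissSource j) (premissTarget j))
        (trans (cong₂ (premiss s (toℕ j))
                      (sym (trans (lookup-map j proj₁ (proj₂ (trigger r)))
                                  (cong proj₁ (lookup-map j _ (premisses r)))))
                      (sym (trans (lookup-map j (isPr ∘ proj₂) (proj₂ (trigger r)))
                                  (cong (isPr ∘ proj₂) (lookup-map j _ (premisses r))))))
               (sym (lookup-premissesOf d f s ss V j)))

    conclusion≡ : conclusion r ≡ conclusionOf d f s ss V
    conclusion≡ = trans
      (conclusionFrom-value d f s ss V (ℓ 𝒱 s f (argsOf d f s ss V) r r∈ trigger≡)
        refl conclusionSource)
      (sym (conclusionOf-conclusionFrom d f s ss V))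

  -- `L` has some rule with the trigger of `r`; by the other inclusion it is a rule of `d`, hence
  -- equal to `r`.
  rulesOf⊆rules : {L : Specification} {d : Law} → IsLawOf L d →
                  ∀ f {r} → r ∈ rulesOf d f → r ∈ rules L f
  rulesOf⊆rules {L} {d} ℓ f {r} r∈ = subst (_∈ rules L f)
    (trigger-injective d f (rules⊆rulesOf {L} {d} ℓ f r₀∈) r∈ (trigger-ruleFor L f (trigger r))) r₀∈
    where r₀∈ = ruleFor-∈ L f (trigger r)

  specifications↔laws : Inverse specifications laws
  specifications↔laws = record
    { to        = lawOf
    ; from      = specificationOf
    ; to-cong   = λ {L} {L′} e →
        isLawOf-cong {L} {L′} {lawOf L} {lawOf L′} e (isLawOf-lawOf L) (isLawOf-lawOf L′)
    ; from-cong = λ {d} {d′} e → specificationOf-≈ {d} {specificationOf d′}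
        (isLawOf-resp {specificationOf d′} {d′} {d} (sym≈ {d} {d′} e) (isLawOf-specificationOf d′))
    ; inverse   =
        (λ {d} {L} e →
          isLawOf-cong {L} {specificationOf d} {lawOf L} {d} e
            (isLawOf-lawOf L) (isLawOf-specificationOf d))
      , (λ {L} {d} e → specificationOf-≈ {d} {L}
          (isLawOf-resp {L} {lawOf L} {d} (sym≈ {d} {lawOf L} e) (isLawOf-lawOf L)))
    }
    where
    open Setoid laws using (_≈_) renaming (sym to sym≈)

    isLawOf-resp : {L : Specification} {d d′ : Law} → d ≈ d′ → IsLawOf L d → IsLawOf L d′
    isLawOf-resp e ℓ X s f as r r∈ e′ =
      subst (Value as (conclusion r)) (e X (s , f , as)) (ℓ X s f as r r∈ e′)

    -- Both the congruence of `from` and the round trip on specifications are instances, after the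
    -- hypothesis is moved along an equality of laws.
    specificationOf-≈ : {d : Law} {L : Specification} → IsLawOf L d →
                        Setoid._≈_ specifications (specificationOf d) L
    specificationOf-≈ {d} {L} ℓ f = rulesOf⊆rules {L} {d} ℓ f , rules⊆rulesOf {L} {d} ℓ f

theorem3p9 : (Sg : Signature) (S : Set) → Countable S →
    let open StatefulSOS Sg S in
    (Σ[ e ∈ Inverse specifications laws ]
    ((∀ L → IsLawOf L (Inverse.to e L)) ×
    (∀ d → IsSpecificationOf d (Inverse.from e d)))) ×
    Inverse laws families
theorem3p9 Sg S _ =
  (specifications↔laws Sg S , isLawOf-lawOf Sg S , λ _ _ → ≐-refl) , laws↔families Sg S
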